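{- Let $X_1,\ldots,X_n$ be pairwise disjoint nonempty finite sets, $X=\bigcup_{i=1}^n X_i$, and let $f:2^X\to\mathbb{R}_{\ge 0}$ be normalized, monotone and submodular. Let $(x_1^*,\ldots,x_n^*)$, with $x_i^*\in X_i$ for each $i$, be an optimal solution, i.e. a maximizer of $f(x_1,\ldots,x_n)$ over all choices $x_i\in X_i$. Suppose $x_1,\ldots,x_n$ are chosen sequentially so that, for each $i\in\{1,\ldots,n\}$, $$x_i\in\operatorname{argmax}_{x\in X_i}\Delta\big(x\mid\{x_1,\ldots,x_{i-1}\}\big),$$ with ties broken arbitrarily. Then $$f(x_1,\ldots,x_n)\ \ge\ \tfrac12\, f(x_1^*,\ldots,x_n^*).$$
   Context: A function $f:2^X\to\mathbb{R}_{\ge0}$ is submodular if $f(A\cup\{x\})-f(A)\ge f(B\cup\{x\})-f(B)$ for all $A\subseteq B\subseteq X$ and $x\in X\setminus B$; monotone if $f(A)\le f(B)$ whenever $A\subseteq B\subseteq X$; normalized if $f(\emptyset)=0$. The marginal reward of $x$ given $A$ is $\Delta(x\mid A)=f(A\cup\{x\})-f(A)$. The notation $f(y_1,\ldots,y_k)$ means $f(\{y_1,\ldots,y_k\})$, and $\{x_1,\ldots,x_0\}$ is the empty set. -}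

module Defs where

open import Data.Fin.Base using (Fin; toℕ)
open import Data.Fin.Subset using (Subset; _∈_; _∉_; _⊆_; _∪_; ⁅_⁆; ⋃; ⊥)
open import Data.List.Base using (List; map; take; tabulate)
open import Data.Nat.Base as ℕ using (ℕ)
import Data.Nat.Properties as ℕ
open import Data.Product.Base using (∃; _×_; _,_; proj₁; proj₂)
open import Data.Rational.Base as ℚ using (ℚ; 0ℚ; 1ℚ; ½; ∣_∣; 1/_)
import Data.Rational.Properties as ℚ
open import Data.Rational.Solver using (module +-*-Solver)
open import Relation.Binary.PropositionalEquality

-- The real numbers, as Cauchy sequences of rationals.  There is no
-- quotient: equality of reals is the relation _≈_ below.

Eventually : (ℕ → Set) → Set
Eventually P = ∃ λ N → ∀ n → N ℕ.≤ n → P n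

Cauchy : (ℕ → ℚ) → Set
Cauchy s = ∀ ε → 0ℚ ℚ.< ε →
  ∃ λ N → ∀ m n → N ℕ.≤ m → N ℕ.≤ n → ∣ s m ℚ.- s n ∣ ℚ.< ε

record ℝ : Set where
  constructor mkℝ
  field
    seq    : ℕ → ℚ
    cauchy : Cauchy seq

open ℝ public

infix  4 _≈_ _≤_
infixl 6 _+_ _-_
infixl 7 _*_
infix  8 -_

_≈_ : ℝ → ℝ → Set
x ≈ y = ∀ ε → 0ℚ ℚ.< ε → Eventually λ n → ∣ seq x n ℚ.- seq y n ∣ ℚ.< ε

-- The slack ε is needed: for instance 1/(n+1) represents 0, so it must be ≤ 0.
_≤_ : ℝ → ℝ → Set
x ≤ y = ∀ ε → 0ℚ ℚ.< ε → Eventually λ n → seq x n ℚ.< seq y n ℚ.+ ε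

private
  half+half : ∀ ε → ½ ℚ.* ε ℚ.+ ½ ℚ.* ε ≡ ε
  half+half ε = trans (sym (ℚ.*-distribʳ-+ ε ½ ½)) (ℚ.*-identityˡ ε)

  half-pos : ∀ {ε} → 0ℚ ℚ.< ε → 0ℚ ℚ.< ½ ℚ.* ε
  half-pos {ε} 0<ε = subst (ℚ._< ½ ℚ.* ε) (ℚ.*-zeroʳ ½) (ℚ.*-monoʳ-<-pos ½ 0<ε)

  ⊔-left : ∀ {M N n} → M ℕ.⊔ N ℕ.≤ n → M ℕ.≤ n
  ⊔-left {M} {N} = ℕ.≤-trans (ℕ.m≤m⊔n M N)

  ⊔-right : ∀ {M N n} → M ℕ.⊔ N ℕ.≤ n → N ℕ.≤ n
  ⊔-right {M} {N} = ℕ.≤-trans (ℕ.m≤n⊔m M N)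

  const-cauchy : ∀ q → Cauchy λ _ → q
  const-cauchy q ε 0<ε =
    0 , λ _ _ _ _ → subst (ℚ._< ε) (cong ∣_∣ (sym (ℚ.+-inverseʳ q))) 0<ε

  +-rearrange : ∀ a b c d →
    (a ℚ.+ b) ℚ.- (c ℚ.+ d) ≡ (a ℚ.- c) ℚ.+ (b ℚ.- d)
  +-rearrange = solve 4 (λ a b c d →
    (a :+ b) :- (c :+ d) := (a :- c) :+ (b :- d)) refl
    where open +-*-Solver

  +-cauchy : ∀ {s t} → Cauchy s → Cauchy t → Cauchy λ n → s n ℚ.+ t n
  +-cauchy {s} {t} cs ct ε 0<ε =
    M ℕ.⊔ N , λ m n p q → begin-strict
      ∣ (s m ℚ.+ t m) ℚ.- (s n ℚ.+ t n) ∣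
        ≡⟨ cong ∣_∣ (+-rearrange (s m) (t m) (s n) (t n)) ⟩
      ∣ (s m ℚ.- s n) ℚ.+ (t m ℚ.- t n) ∣
        ≤⟨ ℚ.∣p+q∣≤∣p∣+∣q∣ (s m ℚ.- s n) (t m ℚ.- t n) ⟩
      ∣ s m ℚ.- s n ∣ ℚ.+ ∣ t m ℚ.- t n ∣
        <⟨ ℚ.+-mono-< (proj₂ (cs _ 0<ε/2) m n (⊔-left p) (⊔-left q))
                      (proj₂ (ct _ 0<ε/2) m n (⊔-right {M} p) (⊔-right {M} q)) ⟩
      ½ ℚ.* ε ℚ.+ ½ ℚ.* ε
        ≡⟨ half+half ε ⟩
      ε ∎
    where
    open ℚ.≤-Reasoning
    0<ε/2 = half-pos 0<ε
    M = proj₁ (cs _ 0<ε/2)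
    N = proj₁ (ct _ 0<ε/2)

  neg-cauchy : ∀ {s} → Cauchy s → Cauchy λ n → ℚ.- s n
  neg-cauchy {s} cs ε 0<ε =
    proj₁ (cs ε 0<ε) , λ m n p q →
      subst (ℚ._< ε) (sym (eq m n)) (proj₂ (cs ε 0<ε) m n p q)
    where
    eq : ∀ m n → ∣ (ℚ.- s m) ℚ.- (ℚ.- s n) ∣ ≡ ∣ s m ℚ.- s n ∣
    eq m n = trans (cong ∣_∣ (sym (ℚ.neg-distrib-+ (s m) (ℚ.- s n))))
                   (ℚ.∣-p∣≡∣p∣ (s m ℚ.- s n))

  bounded : ∀ {s} → Cauchy s →
    ∃ λ B → 0ℚ ℚ.< B × Eventually λ n → ∣ s n ∣ ℚ.< B
  bounded {s} cs =
    1ℚ ℚ.+ ∣ s N ∣ ,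
    ℚ.+-mono-<-≤ 0<1 (ℚ.0≤∣p∣ (s N)) ,
    N , λ n N≤n → begin-strict
      ∣ s n ∣                       ≡⟨ cong ∣_∣ (split (s n) (s N)) ⟩
      ∣ (s n ℚ.- s N) ℚ.+ s N ∣     ≤⟨ ℚ.∣p+q∣≤∣p∣+∣q∣ (s n ℚ.- s N) (s N) ⟩
      ∣ s n ℚ.- s N ∣ ℚ.+ ∣ s N ∣   <⟨ ℚ.+-mono-<-≤ (proj₂ (cs 1ℚ 0<1) n N N≤n ℕ.≤-refl)
                                                   (ℚ.≤-refl {∣ s N ∣}) ⟩
      1ℚ ℚ.+ ∣ s N ∣ ∎
    where
    open ℚ.≤-Reasoning
    0<1 = ℚ.positive⁻¹ 1ℚ
    N = proj₁ (cs 1ℚ 0<1)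
    split : ∀ a b → a ≡ (a ℚ.- b) ℚ.+ b
    split = solve 2 (λ a b → a := (a :- b) :+ b) refl
      where open +-*-Solver

  *-rearrange : ∀ a b c d →
    (a ℚ.* b) ℚ.- (c ℚ.* d) ≡ a ℚ.* (b ℚ.- d) ℚ.+ d ℚ.* (a ℚ.- c)
  *-rearrange = solve 4 (λ a b c d →
    (a :* b) :- (c :* d) := a :* (b :- d) :+ d :* (a :- c)) refl
    where open +-*-Solver

  *-bound : ∀ {B δ} p q → 0ℚ ℚ.< B → ∣ p ∣ ℚ.< B → ∣ q ∣ ℚ.< δ →
    ∣ p ℚ.* q ∣ ℚ.< B ℚ.* δ
  *-bound {B} {δ} p q 0<B p<B q<δ = begin-strict
    ∣ p ℚ.* q ∣       ≡⟨ ℚ.∣p*q∣≡∣p∣*∣q∣ p q ⟩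
    ∣ p ∣ ℚ.* ∣ q ∣   ≤⟨ ℚ.*-monoʳ-≤-nonNeg ∣ q ∣ {{ℚ.nonNegative (ℚ.0≤∣p∣ q)}} (ℚ.<⇒≤ p<B) ⟩
    B ℚ.* ∣ q ∣       <⟨ ℚ.*-monoʳ-<-pos B {{ℚ.positive 0<B}} q<δ ⟩
    B ℚ.* δ ∎
    where open ℚ.≤-Reasoning

  divide : ∀ {C ε} → 0ℚ ℚ.< C → 0ℚ ℚ.< ε → ∃ λ δ → 0ℚ ℚ.< δ × C ℚ.* δ ≡ ε
  divide {C} {ε} 0<C 0<ε = go {{ℚ.positive 0<C}}
    where
    go : {{ℚ.Positive C}} → ∃ λ δ → 0ℚ ℚ.< δ × C ℚ.* δ ≡ ε
    go {{C-pos}} = r ℚ.* ε ,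
      subst (ℚ._< r ℚ.* ε) (ℚ.*-zeroʳ r)
        (ℚ.*-monoʳ-<-pos r {{ℚ.1/pos⇒pos C}} 0<ε) ,
      trans (sym (ℚ.*-assoc C r ε))
        (trans (cong (ℚ._* ε) (ℚ.*-inverseʳ C {{C≢0}})) (ℚ.*-identityˡ ε))
      where
      C≢0 = ℚ.pos⇒nonZero C
      r = 1/_ C {{C≢0}}

  *-close : ∀ {A B δ} a b c d → 0ℚ ℚ.< A → 0ℚ ℚ.< B →
    ∣ a ∣ ℚ.< A → ∣ d ∣ ℚ.< B → ∣ b ℚ.- d ∣ ℚ.< δ → ∣ a ℚ.- c ∣ ℚ.< δ →
    ∣ a ℚ.* b ℚ.- c ℚ.* d ∣ ℚ.< (A ℚ.+ B) ℚ.* δ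
  *-close {A} {B} {δ} a b c d 0<A 0<B a<A d<B b-d a-c = begin-strict
    ∣ a ℚ.* b ℚ.- c ℚ.* d ∣
      ≡⟨ cong ∣_∣ (*-rearrange a b c d) ⟩
    ∣ a ℚ.* (b ℚ.- d) ℚ.+ d ℚ.* (a ℚ.- c) ∣
      ≤⟨ ℚ.∣p+q∣≤∣p∣+∣q∣ (a ℚ.* (b ℚ.- d)) (d ℚ.* (a ℚ.- c)) ⟩
    ∣ a ℚ.* (b ℚ.- d) ∣ ℚ.+ ∣ d ℚ.* (a ℚ.- c) ∣
      <⟨ ℚ.+-mono-< (*-bound a (b ℚ.- d) 0<A a<A b-d)
                    (*-bound d (a ℚ.- c) 0<B d<B a-c) ⟩
    A ℚ.* δ ℚ.+ B ℚ.* δ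
      ≡⟨ sym (ℚ.*-distribʳ-+ δ A B) ⟩
    (A ℚ.+ B) ℚ.* δ ∎
    where open ℚ.≤-Reasoning

  *-cauchy : ∀ {s t} → Cauchy s → Cauchy t → Cauchy λ n → s n ℚ.* t n
  *-cauchy {s} {t} cs ct ε 0<ε = go (bounded cs) (bounded ct)
    where
    Bounded : (ℕ → ℚ) → Set
    Bounded u = ∃ λ B → 0ℚ ℚ.< B × Eventually λ n → ∣ u n ∣ ℚ.< B

    go : Bounded s → Bounded t → ∃ λ N → ∀ m n → N ℕ.≤ m → N ℕ.≤ n →
      ∣ s m ℚ.* t m ℚ.- s n ℚ.* t n ∣ ℚ.< ε
    go (A , 0<A , K , s<A) (B , 0<B , L , t<B) =
      choose (divide (ℚ.+-mono-< 0<A 0<B) 0<ε)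
      where
      choose : (∃ λ δ → 0ℚ ℚ.< δ × (A ℚ.+ B) ℚ.* δ ≡ ε) →
        ∃ λ N → ∀ m n → N ℕ.≤ m → N ℕ.≤ n →
        ∣ s m ℚ.* t m ℚ.- s n ℚ.* t n ∣ ℚ.< ε
      choose (δ , 0<δ , eq) = (K ℕ.⊔ L) ℕ.⊔ (M ℕ.⊔ N) , λ m n p q →
        subst (∣ s m ℚ.* t m ℚ.- s n ℚ.* t n ∣ ℚ.<_) eq
          (*-close (s m) (t m) (s n) (t n) 0<A 0<B
            (s<A m (⊔-left (⊔-left p)))
            (t<B n (⊔-right {K} (⊔-left q)))
            (proj₂ (ct δ 0<δ) m n (⊔-right {M} (⊔-right {K ℕ.⊔ L} p))
                                  (⊔-right {M} (⊔-right {K ℕ.⊔ L} q)))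
            (proj₂ (cs δ 0<δ) m n (⊔-left (⊔-right {K ℕ.⊔ L} p))
                                  (⊔-left (⊔-right {K ℕ.⊔ L} q))))
        where
        M = proj₁ (cs δ 0<δ)
        N = proj₁ (ct δ 0<δ)

fromℚ : ℚ → ℝ
fromℚ q = mkℝ (λ _ → q) (const-cauchy q)

0ℝ : ℝ
0ℝ = fromℚ 0ℚ

_+_ : ℝ → ℝ → ℝ
x + y = mkℝ (λ n → seq x n ℚ.+ seq y n) (+-cauchy {seq x} {seq y} (cauchy x) (cauchy y))

-_ : ℝ → ℝ
- x = mkℝ (λ n → ℚ.- seq x n) (neg-cauchy {seq x} (cauchy x))

_-_ : ℝ → ℝ → ℝ
x - y = x + (- y)

_*_ : ℝ → ℝ → ℝ
x * y = mkℝ (λ n → seq x n ℚ.* seq y n) (*-cauchy {seq x} {seq y} (cauchy x) (cauchy y))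

-- The ground set X is Fin m.
module _ {m : ℕ} where

  Δ : (Subset m → ℝ) → Fin m → Subset m → ℝ
  Δ f x A = f (A ∪ ⁅ x ⁆) - f A

  NonNegative : (Subset m → ℝ) → Set
  NonNegative f = ∀ A → 0ℝ ≤ f A

  Normalized : (Subset m → ℝ) → Set
  Normalized f = f ⊥ ≈ 0ℝ

  Monotone : (Subset m → ℝ) → Set
  Monotone f = ∀ A B → A ⊆ B → f A ≤ f B

  Submodular : (Subset m → ℝ) → Set
  Submodular f = ∀ A B x → A ⊆ B → x ∉ B → Δ f x B ≤ Δ f x A

  IsArgmax : Subset m → (Fin m → ℝ) → Fin m → Set
  IsArgmax S g x = x ∈ S × (∀ y → y ∈ S → g y ≤ g x)

  setOf : List (Fin m) → Subset m
  setOf xs = ⋃ (map ⁅_⁆ xs)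

  module _ {n : ℕ} where

    chosen : (Fin n → Fin m) → Subset m
    chosen x = setOf (tabulate x)

    -- Indices start at 0, so these are the elements chosen strictly before
    -- step i.
    chosenBefore : (Fin n → Fin m) → Fin n → Subset m
    chosenBefore x i = setOf (take (toℕ i) (tabulate x))

    Feasible : (Fin n → Subset m) → (Fin n → Fin m) → Set
    Feasible X x = ∀ i → x i ∈ X i

    IsOptimal : (Fin n → Subset m) → (Subset m → ℝ) → (Fin n → Fin m) → Set
    IsOptimal X f x =
      Feasible X x × (∀ y → Feasible X y → f (chosen y) ≤ f (chosen x))

    IsGreedy : (Fin n → Subset m) → (Subset m → ℝ) → (Fin n → Fin m) → Set
    IsGreedy X f x =
      ∀ i → IsArgmax (X i) (λ y → Δ f y (chosenBefore x i)) (x i)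

{-# OPTIONS --safe #-}
-- Write S and T for the greedy and the optimal set, and Sᵢ and Tᵢ for their
-- first i elements.  By submodularity and the greedy choice, passing from
-- S ∪ Tᵢ to S ∪ Tᵢ₊₁ gains at most what passing from Sᵢ ⊆ S ∪ Tᵢ to Sᵢ₊₁ gains.
-- Hence f (S ∪ Tᵢ) ≤ f S + f Sᵢ by induction on i, and i = n together with
-- monotonicity gives f T ≤ f S + f S.
module Submission where

open import Defs
open import Data.Nat.Base using (ℕ)
open import Data.Fin.Base using (Fin)
open import Data.Fin.Subset using (Subset; Nonempty; Empty; _∩_; ⋃; ⊤)
open import Data.List.Base using (tabulate)
open import Data.Rational.Base using (½)
open import Relation.Binary.PropositionalEquality using (_≡_; _≢_)

open import Data.Fin.Base using (toℕ; inject₁; fromℕ)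
open import Data.Fin.Induction using (<-weakInduction)
open import Data.Fin.Properties using (toℕ-inject₁; toℕ-fromℕ)
open import Data.Fin.Subset using (_∈_; _⊆_; _∪_; ⁅_⁆; ⊥)
open import Data.Fin.Subset.Properties
  using (_∈?_; ⊆-refl; ⊆-trans; p⊆p∪q; q⊆p∪q; x∈⁅y⁆⇒x≡y; x∈p∪q⁻; x∈p∪q⁺; ⊆-min; ⊆-antisym;
         ∪-assoc; ∪-identityˡ; ∪-identityʳ)
open import Data.List.Base using (List; []; _∷_; _∷ʳ_; take)
open import Data.List.Properties
  using (take-suc-tabulate; take-all; length-tabulate)
import Data.Nat.Base as ℕ
import Data.Nat.Properties as ℕ
open import Data.Product.Base using (_,_; proj₁; proj₂)
open import Data.Rational.Base as ℚ using (0ℚ)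
import Data.Rational.Properties as ℚ
open import Data.Rational.Solver using (module +-*-Solver)
open import Data.Sum.Base as Sum using ([_,_])
open import Function.Base using (id)
open import Relation.Binary.PropositionalEquality
  using (refl; sym; trans; cong; subst; subst₂)
open import Relation.Nullary.Decidable.Core using (yes; no)

-- Inequalities between Cauchy reals

-- The slack `ε` turns the weak termwise inequality into the strict one that `_≤_` asks for. Ring
-- identities between reals enter through this lemma: they are checked in `ℚ` index by index,
-- instead of by rewriting along `_≈_`.
pointwise⇒≤ : ∀ x y → (∀ n → seq x n ℚ.≤ seq y n) → x ≤ y
pointwise⇒≤ x y p ε 0<ε = 0 , λ n _ →
  subst (ℚ._< seq y n ℚ.+ ε) (ℚ.+-identityʳ (seq x n)) (ℚ.+-mono-≤-< (p n) 0<ε)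

≤-refl : ∀ x → x ≤ x
≤-refl x = pointwise⇒≤ x x λ _ → ℚ.≤-refl

½-pos : ∀ {ε} → 0ℚ ℚ.< ε → 0ℚ ℚ.< ½ ℚ.* ε
½-pos {ε} 0<ε = subst (ℚ._< ½ ℚ.* ε) (ℚ.*-zeroʳ ½) (ℚ.*-monoʳ-<-pos ½ 0<ε)

≤-trans : ∀ x y z → x ≤ y → y ≤ z → x ≤ z
≤-trans x y z x≤y y≤z ε 0<ε = M ℕ.⊔ N , λ n M⊔N≤n → begin-strict
  seq x n
    <⟨ proj₂ (x≤y _ (½-pos 0<ε)) n (ℕ.m⊔n≤o⇒m≤o M N M⊔N≤n) ⟩
  seq y n ℚ.+ ½ ℚ.* ε
    <⟨ ℚ.+-monoˡ-< (½ ℚ.* ε)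
         (proj₂ (y≤z _ (½-pos 0<ε)) n (ℕ.m⊔n≤o⇒n≤o M N M⊔N≤n)) ⟩
  seq z n ℚ.+ ½ ℚ.* ε ℚ.+ ½ ℚ.* ε
    ≡⟨ solve 2 (λ c e → c :+ con ½ :* e :+ con ½ :* e := c :+ e) refl (seq z n) ε ⟩
  seq z n ℚ.+ ε ∎
  where
  open ℚ.≤-Reasoning
  open +-*-Solver
  M = proj₁ (x≤y _ (½-pos 0<ε))
  N = proj₁ (y≤z _ (½-pos 0<ε))

+-mono-≤ : ∀ x y u v → x ≤ y → u ≤ v → x + u ≤ y + v
+-mono-≤ x y u v x≤y u≤v ε 0<ε = M ℕ.⊔ N , λ n M⊔N≤n → begin-strict
  seq x n ℚ.+ seq u n
    <⟨ ℚ.+-mono-< (proj₂ (x≤y _ (½-pos 0<ε)) n (ℕ.m⊔n≤o⇒m≤o M N M⊔N≤n))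
                  (proj₂ (u≤v _ (½-pos 0<ε)) n (ℕ.m⊔n≤o⇒n≤o M N M⊔N≤n)) ⟩
  (seq y n ℚ.+ ½ ℚ.* ε) ℚ.+ (seq v n ℚ.+ ½ ℚ.* ε)
    ≡⟨ solve 3 (λ b d e → (b :+ con ½ :* e) :+ (d :+ con ½ :* e) := (b :+ d) :+ e)
         refl (seq y n) (seq v n) ε ⟩
  (seq y n ℚ.+ seq v n) ℚ.+ ε ∎
  where
  open ℚ.≤-Reasoning
  open +-*-Solver
  M = proj₁ (x≤y _ (½-pos 0<ε))
  N = proj₁ (u≤v _ (½-pos 0<ε))

x≤x+y : ∀ x y → 0ℝ ≤ y → x ≤ x + y
x≤x+y x y 0≤y = ≤-trans x (x + 0ℝ) (x + y)
  (pointwise⇒≤ x (x + 0ℝ) λ n → ℚ.≤-reflexive (sym (ℚ.+-identityʳ (seq x n))))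
  (+-mono-≤ x x 0ℝ y (≤-refl x) 0≤y)

x-x≤0 : ∀ x → x - x ≤ 0ℝ
x-x≤0 x = pointwise⇒≤ (x - x) 0ℝ λ n → ℚ.≤-reflexive (ℚ.+-inverseʳ (seq x n))

x≤y⇒0≤y-x : ∀ x y → x ≤ y → 0ℝ ≤ y - x
x≤y⇒0≤y-x x y x≤y = ≤-trans 0ℝ (x - x) (y - x)
  (pointwise⇒≤ 0ℝ (x - x) λ n → ℚ.≤-reflexive (sym (ℚ.+-inverseʳ (seq x n))))
  (+-mono-≤ x y (- x) (- x) x≤y (≤-refl (- x)))

-- Adding the two hypotheses cancels `y` on the left and `v` on the right. This is the arithmetic of
-- the induction step: a gain `x - y` is charged to a gain `u - v`, and `z` stays fixed.
x-y≤u-v⇒y≤z+v⇒x≤z+u : ∀ x y z u v → x - y ≤ u - v → y ≤ z + v → x ≤ z + u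
x-y≤u-v⇒y≤z+v⇒x≤z+u x y z u v p q =
  ≤-trans x ((x - y) + y) (z + u)
    (pointwise⇒≤ x ((x - y) + y) λ n → ℚ.≤-reflexive
      (solve 2 (λ a b → a := (a :- b) :+ b) refl (seq x n) (seq y n)))
    (≤-trans ((x - y) + y) ((u - v) + (z + v)) (z + u)
      (+-mono-≤ (x - y) (u - v) y (z + v) p q)
      (pointwise⇒≤ ((u - v) + (z + v)) (z + u) λ n → ℚ.≤-reflexive
        (solve 3 (λ c d e → (d :- e) :+ (c :+ e) := c :+ d)
          refl (seq z n) (seq u n) (seq v n))))
  where open +-*-Solver

x≤y+y⇒½x≤y : ∀ x y → x ≤ y + y → fromℚ ½ * x ≤ y
x≤y+y⇒½x≤y x y p ε 0<ε = proj₁ p′ , λ n N≤n → begin-strict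
  ½ ℚ.* seq x n
    <⟨ ℚ.*-monoʳ-<-pos ½ (proj₂ p′ n N≤n) ⟩
  ½ ℚ.* (seq y n ℚ.+ seq y n ℚ.+ (ε ℚ.+ ε))
    ≡⟨ solve 2 (λ b e → con ½ :* (b :+ b :+ (e :+ e)) := b :+ e) refl (seq y n) ε ⟩
  seq y n ℚ.+ ε ∎
  where
  open ℚ.≤-Reasoning
  open +-*-Solver
  -- Twice the slack, so that halving the inequality leaves exactly `ε`.
  p′ = p (ε ℚ.+ ε) (ℚ.+-mono-< 0<ε 0<ε)

-- Prefixes of a solution as sets

module _ {m : ℕ} where

  -- `⋃` folds from the right, while `Δ` adds its element on the right of the set; associativity
  -- reconciles the two.
  setOf-∷ʳ : (xs : List (Fin m)) (x : Fin m) → setOf (xs ∷ʳ x) ≡ setOf xs ∪ ⁅ x ⁆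
  setOf-∷ʳ []       x = trans (∪-identityʳ ⁅ x ⁆) (sym (∪-identityˡ ⁅ x ⁆))
  setOf-∷ʳ (y ∷ ys) x =
    trans (cong (⁅ y ⁆ ∪_) (setOf-∷ʳ ys x)) (sym (∪-assoc ⁅ y ⁆ (setOf ys) ⁅ x ⁆))

  setOf-take⊆ : ∀ k (xs : List (Fin m)) → setOf (take k xs) ⊆ setOf xs
  setOf-take⊆ ℕ.zero    xs       = ⊆-min (setOf xs)
  setOf-take⊆ (ℕ.suc k) []       = ⊆-refl
  setOf-take⊆ (ℕ.suc k) (x ∷ xs) y∈ = x∈p∪q⁺
    (Sum.map₂ (setOf-take⊆ k xs) (x∈p∪q⁻ ⁅ x ⁆ (setOf (take k xs)) y∈))

  x∈p⇒p∪⁅x⁆≡p : ∀ {p : Subset m} {x} → x ∈ p → p ∪ ⁅ x ⁆ ≡ p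
  x∈p⇒p∪⁅x⁆≡p {p} {x} x∈p = ⊆-antisym
    (λ y∈ → [ id , (λ y∈⁅x⁆ → subst (_∈ p) (sym (x∈⁅y⁆⇒x≡y x y∈⁅x⁆)) x∈p) ]
              (x∈p∪q⁻ p ⁅ x ⁆ y∈))
    (p⊆p∪q ⁅ x ⁆)

  module _ {n : ℕ} (x : Fin n → Fin m) where

    -- Lengths are natural numbers so that length `n` is allowed, which `chosenBefore` cannot
    -- express. At `toℕ i` the two agree definitionally.
    prefix : ℕ → Subset m
    prefix k = setOf (take k (tabulate x))

    prefix-suc : ∀ i → prefix (ℕ.suc (toℕ i)) ≡ chosenBefore x i ∪ ⁅ x i ⁆
    prefix-suc i = trans (cong setOf (take-suc-tabulate x i))
                         (setOf-∷ʳ (take (toℕ i) (tabulate x)) (x i))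

    prefix-all : prefix n ≡ chosen x
    prefix-all = cong setOf (take-all n (tabulate x) (ℕ.≤-reflexive (length-tabulate x)))

  -- Monotonicity supplies the case y ∈ B, which Submodular leaves out.
  Δ-antitone : ∀ f → Monotone {m} f → Submodular f →
    ∀ A B y → A ⊆ B → Δ f y B ≤ Δ f y A
  Δ-antitone f mono sub A B y A⊆B with y ∈? B
  ... | no  y∉B = sub A B y A⊆B y∉B
  ... | yes y∈B = ≤-trans (Δ f y B) 0ℝ (Δ f y A)
    (subst (λ C → f C - f B ≤ 0ℝ) (sym (x∈p⇒p∪⁅x⁆≡p y∈B)) (x-x≤0 (f B)))
    (x≤y⇒0≤y-x (f A) (f (A ∪ ⁅ y ⁆)) (mono A (A ∪ ⁅ y ⁆) (p⊆p∪q ⁅ y ⁆)))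

  -- The prefixes grow in parallel because `y i` is charged to the greedy choice `x i` from the same
  -- block `X i`. The index ranges over `Fin (ℕ.suc n)`, so its last value covers the whole
  -- solutions.
  greedy-prefix-bound : ∀ {n} (X : Fin n → Subset m) f →
    NonNegative f → Monotone f → Submodular f →
    ∀ {x} → IsGreedy X f x → ∀ {y} → Feasible X y → (i : Fin (ℕ.suc n)) →
    f (chosen x ∪ prefix y (toℕ i)) ≤ f (chosen x) + f (prefix x (toℕ i))
  greedy-prefix-bound X f nonneg mono sub {x} greedy {y} feasible =
    <-weakInduction (λ i → Bound (toℕ i))
      -- Both prefixes of length zero are `⊥`, so the bound reduces to nonnegativity of `f ⊥`.
      (subst (λ A → f A ≤ f S + f ⊥) (sym (∪-identityʳ S))
        (x≤x+y (f S) (f ⊥) (nonneg ⊥)))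
      (λ i bound → step i (subst Bound (toℕ-inject₁ i) bound))
    where
    S = chosen x

    Bound : ℕ → Set
    Bound k = f (S ∪ prefix y k) ≤ f S + f (prefix x k)

    step : ∀ i → Bound (toℕ i) → Bound (ℕ.suc (toℕ i))
    step i bound =
      subst₂ (λ A B → f A ≤ f S + f B)
        (trans (∪-assoc S Tᵢ ⁅ y i ⁆) (cong (S ∪_) (sym (prefix-suc y i))))
        (sym (prefix-suc x i))
        (x-y≤u-v⇒y≤z+v⇒x≤z+u
          (f ((S ∪ Tᵢ) ∪ ⁅ y i ⁆)) (f (S ∪ Tᵢ)) (f S) (f (Sᵢ ∪ ⁅ x i ⁆)) (f Sᵢ)
          -- First diminishing returns, then the greedy choice against the competitor `y i`. Since
          -- `y i` may already lie in `S ∪ Tᵢ`, for instance when it equals `x i`, the first link is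
          -- `Δ-antitone` rather than `sub`.
          (≤-trans (Δ f (y i) (S ∪ Tᵢ)) (Δ f (y i) Sᵢ) (Δ f (x i) Sᵢ)
            (Δ-antitone f mono sub Sᵢ (S ∪ Tᵢ) (y i)
              (⊆-trans (setOf-take⊆ (toℕ i) (tabulate x)) (p⊆p∪q Tᵢ)))
            (proj₂ (greedy i) (y i) (feasible i)))
          bound)
      where
      Sᵢ = chosenBefore x i
      Tᵢ = chosenBefore y i

mainTheorem1 : (m n : ℕ) (X : Fin n → Subset m)
    → (∀ i j → i ≢ j → Empty (X i ∩ X j))
    → (∀ i → Nonempty (X i))
    → ⋃ (tabulate X) ≡ ⊤
    → (f : Subset m → ℝ)
    → NonNegative f → Normalized f → Monotone f → Submodular f
    → (x* : Fin n → Fin m) → IsOptimal X f x*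
    → (x : Fin n → Fin m) → IsGreedy X f x
    → fromℚ ½ * f (chosen x*) ≤ f (chosen x)
mainTheorem1 m n X _ _ _ f nonneg _ mono sub x* (feasible , _) x greedy =
  x≤y+y⇒½x≤y (f T) (f S)
    (≤-trans (f T) (f (S ∪ T)) (f S + f S)
      (mono T (S ∪ T) (q⊆p∪q S T))
      -- The bound at the last index, where both prefixes have length `n` and are therefore all of
      -- `T` and `S`.
      (subst₂ (λ A B → f (S ∪ A) ≤ f S + f B) (prefix-all x*) (prefix-all x)
        (subst (λ k → f (S ∪ prefix x* k) ≤ f S + f (prefix x k)) (toℕ-fromℕ n)
          (greedy-prefix-bound X f nonneg mono sub greedy feasible (fromℕ n)))))
  where
  S = chosen x
  T = chosen x*
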